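{- Let $n\ge3$ be odd and let $M$ be the sub-add move matrix. Then the length of every directed cycle in $\Gamma_{M,\,n}$ divides $4\varphi(n)$, where $\varphi$ is Euler's totient function.
   Context: The sub-add move matrix is $M=\begin{pmatrix}1&-1\\1&1\end{pmatrix}$. For $n\in\mathbb N$, $\Gamma_{M,\,n}$ is the directed graph with vertex set $\mathbb Z_n^2$ and arcs $((a,b),(a-b,a+b))$ for all $(a,b)\in\mathbb Z_n^2$ (computed mod $n$; loops allowed). A directed cycle is a cycle in the underlying undirected graph such that in the induced directed subgraph every vertex has in-degree and out-degree $1$; a loop counts as a directed $1$-cycle and a pair of opposite arcs as a directed $2$-cycle. -}

module Defs where

open import Data.Fin.Base using (Fin; toℕ; fromℕ<)
open import Data.Fin.Properties using (nonZeroIndex) renaming (_≟_ to _≟ᶠ_)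
open import Data.Integer.Base using (ℤ; +_; 1ℤ; -1ℤ; _+_; _*_)
open import Data.Integer.DivMod using (_%ℕ_; n%ℕd<d)
open import Data.List.Base using (length; filter; applyUpTo; allFin)
open import Data.Nat.Base using (ℕ; suc; NonZero)
open import Data.Nat.Coprimality using (coprime?)
open import Data.Nat.DivMod using (_mod_)
open import Data.Product.Base using (_×_; _,_)
open import Data.Product.Properties using (≡-dec)
open import Data.Sum.Base using (_⊎_)
open import Data.Vec.Base using (Vec; []; _∷_)
open import Function.Base using (_on_)
open import Function.Definitions using (Injective)
open import Relation.Binary.Core using (Rel)
open import Relation.Binary.Definitions using (Decidable)
open import Relation.Binary.PropositionalEquality.Core using (_≡_)
import Level

-- φ n counts the m with 1 ≤ m ≤ n that are coprime to n.
φ : ℕ → ℕ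
φ n = length (filter (λ m → coprime? m n) (applyUpTo suc n))

-- Loops and pairs of opposite arcs are allowed.
record Digraph : Set₁ where
  field
    Vertex : Set
    Arc    : Rel Vertex Level.zero
    arc?   : Decidable Arc

-- For injective f, the subgraph induced on the image of f, its vertices
-- being named by their indices.
induced : (G : Digraph) {k : ℕ} → (Fin k → Digraph.Vertex G) → Digraph
induced G {k} f = record
  { Vertex = Fin k
  ; Arc    = Arc on f
  ; arc?   = λ i j → arc? (f i) (f j)
  }
  where open Digraph G

module _ (G : Digraph) {k : ℕ} (f : Fin k → Digraph.Vertex G) where
  open Digraph (induced G f)

  inDegree outDegree : Fin k → ℕ
  inDegree  i = length (filter (λ j → arc? j i) (allFin k))
  outDegree i = length (filter (λ j → arc? i j) (allFin k))

-- Cyclic successor: the last index is sent to 0.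
next : ∀ {k} → Fin k → Fin k
next {k} i = _mod_ (suc (toℕ i)) k {{nonZeroIndex i}}

-- The length k may be 1 or 2.  The degree conditions settle these cases:
-- k = 1 is a vertex with a loop, and k = 2 forces both arcs between the two
-- vertices, since a single arc and degrees 1 would need a loop at its head,
-- which would then have in-degree 2.
record DirectedCycle (G : Digraph) (k : ℕ) : Set where
  open Digraph G
  field
    nonEmpty  : NonZero k
    vertex    : Fin k → Vertex
    distinct  : Injective _≡_ _≡_ vertex
    adjacent  : ∀ i → Arc (vertex i) (vertex (next i)) ⊎
                      Arc (vertex (next i)) (vertex i)
    inDegree≡1  : ∀ i → inDegree G vertex i ≡ 1
    outDegree≡1 : ∀ i → outDegree G vertex i ≡ 1

-- ℤ_n is represented by the least residues, i.e. by Fin n.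
residue : ∀ n .{{_ : NonZero n}} → ℤ → Fin n
residue n z = fromℕ< (n%ℕd<d z n)

-- A list of rows, acting on column vectors.
Matrix₂ : Set
Matrix₂ = Vec (Vec ℤ 2) 2

-- The NonZero instance comes from Fin n being inhabited; no n is excluded.
move : Matrix₂ → ∀ {n} → Fin n × Fin n → Fin n × Fin n
move ((p ∷ q ∷ []) ∷ (r ∷ s ∷ []) ∷ []) {n} (a , b) =
  red (p * + toℕ a + q * + toℕ b) , red (r * + toℕ a + s * + toℕ b)
  where
  red : ℤ → Fin n
  red = residue n {{nonZeroIndex a}}

Γ : Matrix₂ → ℕ → Digraph
Γ M n = record
  { Vertex = Fin n × Fin n
  ; Arc    = λ u w → w ≡ move M u
  ; arc?   = λ u w → ≡-dec _≟ᶠ_ _≟ᶠ_ w (move M u)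
  }

subAdd : Matrix₂
subAdd = (1ℤ ∷ -1ℤ ∷ [])
       ∷ (1ℤ ∷  1ℤ ∷ [])
       ∷ []

module Submission where

-- Since move⁴ is multiplication by −4, Euler's theorem shows that move has
-- order dividing 4 φ(n) on ℤ_n².  Out-degree 1 makes the vertices of a
-- directed cycle closed under move, and adjacency then makes them a single
-- orbit, whose size divides the order.

open import Defs
open import Data.Empty using (⊥-elim)
open import Data.Fin.Base using (Fin; zero; suc; toℕ; fromℕ<)
open import Data.Fin.Properties
  using (toℕ-injective; toℕ-fromℕ<; toℕ<n; fromℕ<-toℕ; cantor-schröder-bernstein)
  renaming (_≟_ to _≟ᶠ_)
open import Data.Integer.Base as ℤ using (ℤ; +_; 1ℤ; -1ℤ)
import Data.Integer.Coprimality as ℤ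
open import Data.Integer.DivMod using (_%ℕ_; _/ℕ_; n%ℕd<d; a≡a%ℕn+[a/ℕn]*n)
open import Data.Integer.Divisibility.Signed as Signed using (∣⇒∣ᵤ; ∣ᵤ⇒∣; divides)
import Data.Integer.Properties as ℤ
open import Data.Integer.Tactic.RingSolver using (solve-∀)
open import Data.List.Base
  using (List; []; _∷_; _++_; map; filter; length; applyUpTo; allFin)
open import Data.List.Membership.Propositional using (_∈_)
open import Data.List.Membership.Propositional.Properties
  using (∈-∃++; ∈-map⁻; ∈-filter⁺; ∈-filter⁻; ∈-applyUpTo⁺; ∈-applyUpTo⁻)
open import Data.List.Properties using (length-map)
open import Data.List.Relation.Binary.Permutation.Propositional
  using (_↭_; prep; ↭-sym; ↭-trans; ↭-refl)
open import Data.List.Relation.Binary.Permutation.Propositional.Properties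
  using (shift; ↭-length; ∈-resp-↭)
open import Data.List.Relation.Binary.Subset.Propositional using (_⊆_)
open import Data.List.Relation.Unary.All using (lookup; tabulate)
open import Data.List.Relation.Unary.AllPairs using ([]; _∷_)
open import Data.List.Relation.Unary.Any using (here; there)
open import Data.List.Relation.Unary.Unique.Propositional using (Unique)
open import Data.List.Relation.Unary.Unique.Propositional.Properties
  using (filter⁺; applyUpTo⁺₁)
open import Data.Nat.Base hiding (_/_; _%_)
open import Data.Nat.Coprimality as Coprimality
  using (Coprime; coprime?; coprime-divisor; ¬0-coprimeTo-2+)
open import Data.Nat.DivMod using (_%_; _/_; m%n<n; m<n⇒m%n≡m; m≡m%n+[m/n]*n)
open import Data.Nat.Divisibility
  using (_∣_; _∤_; _∣0; ∣-refl; ∣-trans; >⇒∤; m%n≡0⇒n∣m)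
open import Data.Nat.GeneralisedArithmetic using (fold; fold-+)
open import Data.Nat.Induction using (<-rec)
open import Data.Nat.ListAction using (product)
open import Data.Nat.ListAction.Properties using (product-↭)
open import Data.Nat.Primality using (Prime; prime[2]; prime⇒irreducible)
open import Data.Nat.Properties
open import Data.Product.Base using (∃; _×_; _,_; proj₁; proj₂)
open import Data.Product.Properties using (≡-dec)
open import Data.Sum.Base using (_⊎_; inj₁; inj₂)
open import Function.Base using (_∘_)
open import Function.Definitions using (Injective)
open import Relation.Binary.Bundles using (Setoid)
open import Relation.Binary.Definitions using (DecidableEquality; tri<; tri≈; tri>)
open import Relation.Binary.PropositionalEquality
open import Relation.Nullary.Decidable.Core using (yes; no)
open import Relation.Nullary.Negation using (¬_; contradiction)
open import Relation.Unary using (Pred; Decidable)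

-- Euler's theorem

-- Pigeonhole, cutting one entry of `xs` out of `ys` at a time: distinctness sends the later entries
-- into what remains, and the length bound leaves nothing over at the end.
⊆∧length≥⇒↭ : ∀ {a} {A : Set a} {xs ys : List A} → Unique xs → xs ⊆ ys →
              length ys ≤ length xs → xs ↭ ys
⊆∧length≥⇒↭ {xs = []}     {[]}   _ _ _ = ↭-refl
⊆∧length≥⇒↭ {xs = x ∷ xs} {ys} (x∉xs ∷ xs!) xs⊆ys ∣ys∣≤
  with as , bs , refl ← ∈-∃++ (xs⊆ys (here refl)) =
  ↭-trans (prep x (⊆∧length≥⇒↭ xs! xs⊆as++bs
                    (s≤s⁻¹ (subst (_≤ _) (↭-length (shift x as bs)) ∣ys∣≤))))
          (↭-sym (shift x as bs))
  where
  xs⊆as++bs : xs ⊆ as ++ bs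
  xs⊆as++bs z∈xs with ∈-resp-↭ (shift x as bs) (xs⊆ys (there z∈xs))
  ... | here refl = contradiction refl (lookup x∉xs z∈xs)
  ... | there z∈  = z∈

-- Injectivity is asked on the entries only, because multiplication by `c` mod `n` identifies
-- numbers that differ by a multiple of `n`.
map-unique : ∀ {a b} {A : Set a} {B : Set b} {f : A → B} {xs : List A} →
             (∀ {x y} → x ∈ xs → y ∈ xs → f x ≡ f y → x ≡ y) →
             Unique xs → Unique (map f xs)
map-unique {xs = []}     f-inj []           = []
map-unique {f = f} {xs = x ∷ xs} f-inj (x∉xs ∷ xs!) =
  tabulate fx≢ ∷ map-unique (λ p q → f-inj (there p) (there q)) xs!
  where
  fx≢ : ∀ {y} → y ∈ map f xs → f x ≢ y
  fx≢ y∈ fx≡y with z , z∈xs , refl ← ∈-map⁻ f y∈ =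
    lookup x∉xs z∈xs (f-inj (here refl) (there z∈xs) fx≡y)

-- A common divisor `d` of `m * n` and `o` is coprime to `m`, as it divides `o`; by Euclid's lemma
-- it then divides `n`.
coprime-* : ∀ {m n o} → Coprime m o → Coprime n o → Coprime (m * n) o
coprime-* {m} c c′ {d} (d∣mn , d∣o) = c′ (coprime-divisor d⊥m d∣mn , d∣o)
  where
  d⊥m : Coprime d m
  d⊥m (e∣d , e∣m) = c (e∣m , ∣-trans e∣d d∣o)

coprime-product : ∀ {n ms} → (∀ {m} → m ∈ ms → Coprime m n) → Coprime (product ms) n
coprime-product {ms = []}     _ = Coprimality.1-coprimeTo _
coprime-product {ms = m ∷ ms} c =
  coprime-* (c (here refl)) (coprime-product {ms = ms} (λ m∈ → c (there m∈)))

-- Congruence of integers modulo n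

infix 4 _≈_[mod_]

-- A record, so that `x` and `y` can be inferred from the type; they could not be recovered from
-- their difference.
record _≈_[mod_] (x y : ℤ) (n : ℕ) : Set where
  constructor mk≈
  field n∣x-y : + n Signed.∣ x ℤ.- y

module _ {n : ℕ} where
  private
    infix 4 _≋_
    _≋_ : ℤ → ℤ → Set
    x ≋ y = x ≈ y [mod n ]

  ≈-refl : ∀ {x} → x ≋ x
  ≈-refl {x} = mk≈ (divides (+ 0) (ℤ.i≡j⇒i-j≡0 {x} refl))

  ≈-reflexive : ∀ {x y} → x ≡ y → x ≋ y
  ≈-reflexive refl = ≈-refl

  ≈-sym : ∀ {x y} → x ≋ y → y ≋ x
  ≈-sym {x} {y} (mk≈ p) = mk≈ (subst (+ n Signed.∣_) (lemma x y) (Signed.∣m⇒∣-m p))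
    where
    lemma : ∀ x y → ℤ.- (x ℤ.- y) ≡ y ℤ.- x
    lemma = solve-∀

  ≈-trans : ∀ {x y z} → x ≋ y → y ≋ z → x ≋ z
  ≈-trans {x} {y} {z} (mk≈ p) (mk≈ q) =
    mk≈ (subst (+ n Signed.∣_) (lemma x y z) (Signed.∣m∣n⇒∣m+n p q))
    where
    lemma : ∀ x y z → (x ℤ.- y) ℤ.+ (y ℤ.- z) ≡ x ℤ.- z
    lemma = solve-∀

  +-cong : ∀ {x y z w} → x ≋ y → z ≋ w → (x ℤ.+ z) ≋ (y ℤ.+ w)
  +-cong {x} {y} {z} {w} (mk≈ p) (mk≈ q) =
    mk≈ (subst (+ n Signed.∣_) (lemma x y z w) (Signed.∣m∣n⇒∣m+n p q))
    where
    lemma : ∀ x y z w → (x ℤ.- y) ℤ.+ (z ℤ.- w) ≡ (x ℤ.+ z) ℤ.- (y ℤ.+ w)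
    lemma = solve-∀

  *-cong : ∀ {x y z w} → x ≋ y → z ≋ w → (x ℤ.* z) ≋ (y ℤ.* w)
  *-cong {x} {y} {z} {w} (mk≈ p) (mk≈ q) =
    mk≈ (subst (+ n Signed.∣_) (lemma x y z w)
          (Signed.∣m∣n⇒∣m+n (Signed.∣n⇒∣m*n z p) (Signed.∣n⇒∣m*n y q)))
    where
    lemma : ∀ x y z w → z ℤ.* (x ℤ.- y) ℤ.+ y ℤ.* (z ℤ.- w) ≡ x ℤ.* z ℤ.- y ℤ.* w
    lemma = solve-∀

  -- Euclid's lemma: `n` divides `z` times the difference of `x` and `y`, and is coprime to `z`.
  *-cancelʳ : ∀ {x y} z → Coprime ℤ.∣ z ∣ n → (x ℤ.* z) ≋ (y ℤ.* z) → x ≋ y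
  *-cancelʳ {x} {y} z z⊥n (mk≈ p) = mk≈ (∣ᵤ⇒∣
    (ℤ.coprime-divisor (+ n) z (x ℤ.- y) (Coprimality.sym z⊥n)
      (∣⇒∣ᵤ (subst (+ n Signed.∣_) (lemma x y z) p))))
    where
    lemma : ∀ x y z → x ℤ.* z ℤ.- y ℤ.* z ≡ z ℤ.* (x ℤ.- y)
    lemma = solve-∀

  ≈-setoid : Setoid _ _
  ≈-setoid = record
    { Carrier = ℤ
    ; _≈_     = _≋_
    ; isEquivalence = record { refl = ≈-refl ; sym = ≈-sym ; trans = ≈-trans }
    }

  module _ .{{_ : NonZero n}} where

    %ℕ-≈ : ∀ x → + (x %ℕ n) ≋ x
    %ℕ-≈ x = ≈-sym (mk≈ (divides (x /ℕ n)
      (trans (cong (ℤ._- + (x %ℕ n)) (a≡a%ℕn+[a/ℕn]*n x n)) (lemma (+ (x %ℕ n)) _))))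
      where
      lemma : ∀ r s → r ℤ.+ s ℤ.- r ≡ s
      lemma = solve-∀

  -- The difference of two least residues is at most their maximum in absolute value, hence a
  -- multiple of `n` below `n`, which can only be 0.
  ≈⇒≡ : ∀ {r s} → r < n → s < n → + r ≋ + s → r ≡ s
  ≈⇒≡ {r} {s} r<n s<n (mk≈ p) = ℤ.+-injective (ℤ.i-j≡0⇒i≡j (+ r) (+ s)
    (ℤ.∣i∣≡0⇒i≡0 (vanishes _ (∣⇒∣ᵤ p) (≤-<-trans bound (⊔-lub r<n s<n)))))
    where
    bound : ℤ.∣ + r ℤ.- + s ∣ ≤ r ⊔ s
    bound = subst (λ z → ℤ.∣ z ∣ ≤ r ⊔ s) (sym (ℤ.m-n≡m⊖n r s)) (ℤ.∣m⊝n∣≤m⊔n r s)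
    vanishes : ∀ d → n ∣ d → d < n → d ≡ 0
    vanishes zero    _   _   = refl
    vanishes (suc d) n∣d d<n = contradiction n∣d (>⇒∤ d<n)

  %ℕ-cong : .{{_ : NonZero n}} → ∀ {x y} → x ≋ y → x %ℕ n ≡ y %ℕ n
  %ℕ-cong {x} {y} x≈y = ≈⇒≡ (n%ℕd<d x n) (n%ℕd<d y n)
    (≈-trans (%ℕ-≈ x) (≈-trans x≈y (≈-sym (%ℕ-≈ y))))

  -- A common divisor of `y` and `n` also divides `x`, which is `y` plus a multiple of `n`.
  ≈-coprime : ∀ {x y} → x ≋ y → Coprime ℤ.∣ x ∣ n → Coprime ℤ.∣ y ∣ n
  ≈-coprime {x} {y} (mk≈ p) x⊥n {d} (d∣y , d∣n) = x⊥n
    (∣⇒∣ᵤ {+ d} (subst (+ d Signed.∣_) (lemma x y) (Signed.∣m∣n⇒∣m+n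
       (Signed.∣-trans (∣ᵤ⇒∣ d∣n) p) (∣ᵤ⇒∣ d∣y))) , d∣n)
    where
    lemma : ∀ x y → x ℤ.- y ℤ.+ y ≡ x
    lemma = solve-∀

-- Multiplication by a unit modulo n

module Euler (n : ℕ) .{{_ : NonTrivial n}} (c : ℤ) (c⊥n : Coprime ℤ.∣ c ∣ n) where
  private
    instance
      n≢0 : NonZero n
      n≢0 = nonTrivial⇒nonZero n

    -- The very list that `φ` counts, so that `length units` is `φ n` by definition.
    units : List ℕ
    units = filter (λ m → coprime? m n) (applyUpTo suc n)

    units-unique : Unique units
    units-unique = filter⁺ _ (applyUpTo⁺₁ suc n λ i<j _ eq → <⇒≢ i<j (suc-injective eq))

    unit-coprime : ∀ {m} → m ∈ units → Coprime m n
    unit-coprime m∈ = proj₂ (∈-filter⁻ (λ m → coprime? m n) {xs = applyUpTo suc n} m∈)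

    unit-< : ∀ {m} → m ∈ units → m < n
    unit-< m∈ with ∈-filter⁻ (λ m → coprime? m n) {xs = applyUpTo suc n} m∈
    ... | m∈range , m⊥n with i , i<n , refl ← ∈-applyUpTo⁻ suc m∈range =
      -- The range includes `n` itself, but a nontrivial `n` is not coprime to itself.
      ≤∧≢⇒< i<n λ { refl → nonTrivial⇒≢1 {n} (m⊥n (∣-refl , ∣-refl)) }

    <∧coprime⇒unit : ∀ {m} → m < n → Coprime m n → m ∈ units
    -- The range starts at 1, and the residue 0 is coprime only to 1.
    <∧coprime⇒unit {zero}  _   m⊥n = ⊥-elim (¬0-coprimeTo-2+ m⊥n)
    <∧coprime⇒unit {suc m} m<n m⊥n =
      ∈-filter⁺ (λ m → coprime? m n) (∈-applyUpTo⁺ suc (<-trans (n<1+n m) m<n)) m⊥n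

    times-c : ℕ → ℕ
    times-c m = (c ℤ.* + m) %ℕ n

    times-c-unit : ∀ {m} → m ∈ units → times-c m ∈ units
    times-c-unit {m} m∈ = <∧coprime⇒unit (n%ℕd<d (c ℤ.* + m) n)
      (≈-coprime (≈-sym (%ℕ-≈ (c ℤ.* + m)))
        (subst (λ a → Coprime a n) (sym (ℤ.abs-* c (+ m))) (coprime-* c⊥n (unit-coprime m∈))))

    times-c-injective : ∀ {x y} → x ∈ units → y ∈ units → times-c x ≡ times-c y → x ≡ y
    times-c-injective {x} {y} x∈ y∈ eq = ≈⇒≡ (unit-< x∈) (unit-< y∈)
      (*-cancelʳ c c⊥n (begin
        + x ℤ.* c           ≡⟨ ℤ.*-comm (+ x) c ⟩
        c ℤ.* + x           ≈⟨ %ℕ-≈ (c ℤ.* + x) ⟨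
        + (times-c x)       ≡⟨ cong +_ eq ⟩
        + (times-c y)       ≈⟨ %ℕ-≈ (c ℤ.* + y) ⟩
        c ℤ.* + y           ≡⟨ ℤ.*-comm c (+ y) ⟩
        + y ℤ.* c           ∎))
      where open import Relation.Binary.Reasoning.Setoid (≈-setoid {n})

    -- An injective map of a finite set into itself is onto.
    times-c-permutes : map times-c units ↭ units
    times-c-permutes = ⊆∧length≥⇒↭ (map-unique times-c-injective units-unique)
      image⊆ (≤-reflexive (sym (length-map times-c units)))
      where
      image⊆ : map times-c units ⊆ units
      image⊆ y∈ with x , x∈ , refl ← ∈-map⁻ times-c y∈ = times-c-unit x∈

    product-times-c : ∀ ms → + product (map times-c ms) ≈ c ℤ.^ length ms ℤ.* + product ms [mod n ]
    product-times-c []       = ≈-refl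
    product-times-c (m ∷ ms) = begin
      + (times-c m * product (map times-c ms))
        ≡⟨ ℤ.pos-* (times-c m) _ ⟩
      + times-c m ℤ.* + product (map times-c ms)
        ≈⟨ *-cong (%ℕ-≈ (c ℤ.* + m)) (product-times-c ms) ⟩
      c ℤ.* + m ℤ.* (c ℤ.^ length ms ℤ.* + product ms)
        ≡⟨ lemma c (+ m) (c ℤ.^ length ms) (+ product ms) ⟩
      c ℤ.^ length (m ∷ ms) ℤ.* (+ m ℤ.* + product ms)
        ≡⟨ cong (c ℤ.^ length (m ∷ ms) ℤ.*_) (ℤ.pos-* m (product ms)) ⟨
      c ℤ.^ length (m ∷ ms) ℤ.* + product (m ∷ ms)
        ∎
      where
      open import Relation.Binary.Reasoning.Setoid (≈-setoid {n})
      lemma : ∀ x y z w → x ℤ.* y ℤ.* (z ℤ.* w) ≡ x ℤ.* z ℤ.* (y ℤ.* w)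
      lemma = solve-∀

  -- Multiplying all units by `c` permutes them, so it leaves their product unchanged, yet it also
  -- contributes `φ n` factors `c`. The product is coprime to `n` and cancels.
  euler : c ℤ.^ φ n ≈ + 1 [mod n ]
  euler = *-cancelʳ (+ product units) (coprime-product {ms = units} unit-coprime) (begin
    c ℤ.^ φ n ℤ.* + product units     ≈⟨ product-times-c units ⟨
    + product (map times-c units)     ≡⟨ cong +_ (product-↭ times-c-permutes) ⟩
    + product units                   ≡⟨ ℤ.*-identityˡ _ ⟨
    + 1 ℤ.* + product units           ∎)
    where open import Relation.Binary.Reasoning.Setoid (≈-setoid {n})

-- Orbits and cyclic orders

-- Descent: a bounded search below the current witness either finds a smaller one or proves
-- minimality.
least : ∀ {p} {P : Pred ℕ p} → Decidable P → ∀ {n} → P n →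
        ∃ λ m → P m × (∀ {j} → j < m → ¬ P j)
least {P = P} P? {n} = <-rec (λ n → P n → _) search n
  where
  search : ∀ n → (∀ {m} → m < n → P m → _) → P n →
           ∃ λ m → P m × (∀ {j} → j < m → ¬ P j)
  search n rec Pn with anyUpTo? P? n
  ... | yes (m , m<n , Pm) = rec m<n Pm
  ... | no none            = n , Pn , λ j<n Pj → none (_ , j<n , Pj)

toℕ-next : ∀ {k} (i : Fin k) → suc (toℕ i) < k → toℕ (next i) ≡ suc (toℕ i)
toℕ-next {suc k} i 1+i<k = trans (toℕ-fromℕ< _) (m<n⇒m%n≡m 1+i<k)

-- Counting up from `zero`, `next` visits every index before it wraps around, so induction on the
-- value of the index suffices.
next-induction : ∀ {p k} (P : Pred (Fin (suc k)) p) → P zero →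
                 (∀ i → P i → P (next i)) → ∀ i → P i
next-induction {k = k} P P0 Pnext i =
  subst P (fromℕ<-toℕ i (toℕ<n i)) (from (toℕ i) (toℕ<n i))
  where
  from : ∀ m (m<k : m < suc k) → P (fromℕ< m<k)
  from zero    (s≤s z≤n) = P0
  from (suc m) 1+m<k = subst P next≡ (Pnext j (from m m<k))
    where
    m<k = <-trans (n<1+n m) 1+m<k
    j = fromℕ< m<k
    toℕ-j = toℕ-fromℕ< m<k
    next≡ : next j ≡ fromℕ< 1+m<k
    next≡ = toℕ-injective (trans
      (trans (toℕ-next j (subst (λ t → suc t < suc k) (sym toℕ-j) 1+m<k))
             (cong suc toℕ-j))
      (sym (toℕ-fromℕ< 1+m<k)))

module _ {a} {A : Set a} (f : A → A) where

  fold-suc : ∀ x m → fold x f (suc m) ≡ fold (f x) f m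
  fold-suc x m = trans (cong (fold x f) (+-comm 1 m)) (fold-+ x f m)

  fold-multiple : ∀ {x} d → fold x f d ≡ x → ∀ q → fold x f (q * d) ≡ x
  fold-multiple     d eq zero    = refl
  fold-multiple {x} d eq (suc q) = begin
    fold x f (d + q * d)        ≡⟨ fold-+ x f d ⟩
    fold (fold x f (q * d)) f d ≡⟨ cong (λ y → fold y f d) (fold-multiple d eq q) ⟩
    fold x f d                  ≡⟨ eq ⟩
    x                           ∎
    where open ≡-Reasoning

  fold-% : ∀ {x} d .{{_ : NonZero d}} → fold x f d ≡ x →
           ∀ m → fold x f m ≡ fold x f (m % d)
  fold-% {x} d eq m = begin
    fold x f m                              ≡⟨ cong (fold x f) (m≡m%n+[m/n]*n m d) ⟩
    fold x f (m % d + m / d * d)            ≡⟨ fold-+ x f (m % d) ⟩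
    fold (fold x f (m / d * d)) f (m % d)   ≡⟨ cong (λ y → fold y f (m % d)) (fold-multiple d eq (m / d)) ⟩
    fold x f (m % d)                        ∎
    where open ≡-Reasoning

  module _ {x : A} {d : ℕ} (return : fold x f d ≡ x)
           (minimal : ∀ {j} → 0 < j → j < d → fold x f j ≢ x) where

    -- Applying `f` another `d ∸ j` times to the supposed equality gives a return to `x` after
    -- `d ∸ j + i` steps, a positive number below `d`.
    orbit-distinct : ∀ {i j} → i < j → j < d → fold x f i ≢ fold x f j
    orbit-distinct {i} {j} i<j j<d eq =
      minimal (<-≤-trans (m<n⇒0<n∸m j<d) (m≤m+n _ i))
              (subst (d ∸ j + i <_) (m∸n+n≡m (<⇒≤ j<d)) (+-monoʳ-< (d ∸ j) i<j))
              (begin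
      fold x f (d ∸ j + i)        ≡⟨ fold-+ x f (d ∸ j) ⟩
      fold (fold x f i) f (d ∸ j) ≡⟨ cong (λ y → fold y f (d ∸ j)) eq ⟩
      fold (fold x f j) f (d ∸ j) ≡⟨ fold-+ x f (d ∸ j) ⟨
      fold x f (d ∸ j + j)        ≡⟨ cong (fold x f) (m∸n+n≡m (<⇒≤ j<d)) ⟩
      fold x f d                  ≡⟨ return ⟩
      x                           ∎)
      where open ≡-Reasoning

    orbit-injective : ∀ {i j} → i < d → j < d → fold x f i ≡ fold x f j → i ≡ j
    orbit-injective {i} {j} i<d j<d eq with <-cmp i j
    ... | tri< i<j _ _ = contradiction eq (orbit-distinct i<j j<d)
    ... | tri≈ _ i≡j _ = i≡j
    ... | tri> _ _ j<i = contradiction (sym eq) (orbit-distinct j<i i<d)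

    -- The remainder of `m` modulo `d` is again a return time, and it is below the least positive
    -- one, so it is 0.
    period-∣ : .{{_ : NonZero d}} → ∀ {m} → fold x f m ≡ x → d ∣ m
    period-∣ {m} eq = m%n≡0⇒n∣m m d (vanishes (m % d) (m%n<n m d)
                        (trans (sym (fold-% d return m)) eq))
      where
      vanishes : ∀ r → r < d → fold x f r ≡ x → r ≡ 0
      vanishes zero    _   _   = refl
      vanishes (suc r) r<d eq′ = contradiction eq′ (minimal z<s r<d)

-- Since f ^ N = id, a backward step is a forward one by f ^ (N − 1), so the
-- vertices form a single orbit of f.
cycle-length-∣ :
  ∀ {a} {A : Set a} → DecidableEquality A → (f : A → A) →
  ∀ {k} .{{_ : NonZero k}} (v : Fin k → A) → Injective _≡_ _≡_ v →
  (∀ i → ∃ λ j → v j ≡ f (v i)) →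
  (∀ i → v (next i) ≡ f (v i) ⊎ v i ≡ f (v (next i))) →
  ∀ N → (∀ x → fold x f N ≡ x) → k ∣ N
cycle-length-∣ _ _ {k} _ _ _ _ zero _ = k ∣0
cycle-length-∣ _≟_ f {suc k} v v-injective closed adjacent N@(suc N-1) period =
  subst (_∣ N) d≡k (period-∣ f return minimal (period x))
  where
  x = v zero

  orb : ℕ → _
  orb = fold x f

  reached : ∀ i → ∃ λ m → v i ≡ orb m
  reached = next-induction _ (0 , refl) step
    where
    step : ∀ i → (∃ λ m → v i ≡ orb m) → ∃ λ m → v (next i) ≡ orb m
    step i (m , eq) with adjacent i
    ... | inj₁ forward  = suc m , trans forward (cong f eq)
    ... | inj₂ backward = N-1 + m , (begin
      v (next i)                    ≡⟨ period _ ⟨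
      fold (v (next i)) f N         ≡⟨ fold-suc f _ N-1 ⟩
      fold (f (v (next i))) f N-1   ≡⟨ cong (λ y → fold y f N-1) (trans (sym backward) eq) ⟩
      fold (orb m) f N-1            ≡⟨ fold-+ x f N-1 ⟨
      orb (N-1 + m)                 ∎)
      where open ≡-Reasoning

  -- Conversely to `reached`, the orbit never leaves the cycle, since `closed` gives an index for
  -- each image under `f`.
  visited : ∀ m → ∃ λ i → v i ≡ orb m
  visited zero    = zero , refl
  visited (suc m) with i , eq ← visited m | j , eq′ ← closed (proj₁ (visited m)) =
    j , trans eq′ (cong f eq)

  -- The search runs over predecessors, which keeps the return time `d` positive; `N-1` is a witness
  -- because `f` iterated `N` times fixes `x`.
  least-return = least (λ m → orb (suc m) ≟ x) {N-1} (period x)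
  d      = suc (proj₁ least-return)
  return = proj₁ (proj₂ least-return)

  minimal : ∀ {j} → 0 < j → j < d → orb j ≢ x
  minimal {suc j} _ (s≤s j<d) = proj₂ (proj₂ least-return) j<d

  -- The `d` distinct orbit points and the `suc k` distinct vertices form the same set; injections
  -- of the index sets both ways make the two numbers equal.
  toCycle : Fin d → Fin (suc k)
  toCycle m = proj₁ (visited (toℕ m))

  toOrbit : Fin (suc k) → Fin d
  toOrbit i = fromℕ< (m%n<n (proj₁ (reached i)) d)

  toCycle-injective : Injective _≡_ _≡_ toCycle
  toCycle-injective {i} {j} eq = toℕ-injective
    (orbit-injective f return minimal (toℕ<n i) (toℕ<n j)
      (trans (sym (proj₂ (visited (toℕ i))))
             (trans (cong v eq) (proj₂ (visited (toℕ j))))))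

  toOrbit-reaches : ∀ i → v i ≡ orb (toℕ (toOrbit i))
  toOrbit-reaches i = trans (proj₂ (reached i))
    (trans (fold-% f d return (proj₁ (reached i)))
           (cong orb (sym (toℕ-fromℕ< (m%n<n (proj₁ (reached i)) d)))))

  toOrbit-injective : Injective _≡_ _≡_ toOrbit
  toOrbit-injective {i} {j} eq = v-injective
    (trans (toOrbit-reaches i)
           (trans (cong (orb ∘ toℕ) eq) (sym (toOrbit-reaches j))))

  d≡k : d ≡ suc k
  d≡k = cantor-schröder-bernstein toCycle-injective toOrbit-injective

-- The sub-add move

prime∧∤⇒coprime : ∀ {p n} → Prime p → p ∤ n → Coprime p n
prime∧∤⇒coprime pr p∤n (d∣p , d∣n) with prime⇒irreducible pr d∣p
... | inj₁ d≡1  = d≡1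
... | inj₂ refl = contradiction d∣n p∤n

-4ℤ : ℤ
-4ℤ = ℤ.- + 4

module _ {n : ℕ} .{{_ : NonZero n}} where

  residue-cong : ∀ {x y} → x ≈ y [mod n ] → residue n x ≡ residue n y
  residue-cong {x} {y} x≈y = toℕ-injective
    (trans (toℕ-fromℕ< (n%ℕd<d x n))
           (trans (%ℕ-cong x≈y) (sym (toℕ-fromℕ< (n%ℕd<d y n)))))

  residue-toℕ : ∀ (a : Fin n) → residue n (+ toℕ a) ≡ a
  residue-toℕ a = toℕ-injective
    (trans (toℕ-fromℕ< (n%ℕd<d (+ toℕ a) n)) (m<n⇒m%n≡m (toℕ<n a)))

  toℕ-residue : ∀ x → + toℕ (residue n x) ≈ x [mod n ]
  toℕ-residue x =
    ≈-trans (≈-reflexive (cong +_ (toℕ-fromℕ< (n%ℕd<d x n)))) (%ℕ-≈ x)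

  -- Reducing the arguments before a linear combination does not change its residue, so successive
  -- moves can be computed in the integers and reduced once.
  linear-residue : ∀ p q x y →
    residue n (p ℤ.* + toℕ (residue n x) ℤ.+ q ℤ.* + toℕ (residue n y)) ≡
    residue n (p ℤ.* x ℤ.+ q ℤ.* y)
  linear-residue p q x y = residue-cong
    (+-cong (*-cong (≈-refl {x = p}) (toℕ-residue x)) (*-cong (≈-refl {x = q}) (toℕ-residue y)))

  -- Arbitrary integer representatives are allowed, which lets iterates of the move be written as
  -- polynomials.
  point : ℤ → ℤ → Fin n × Fin n
  point x y = residue n x , residue n y

  move-point : ∀ x y → move subAdd (point x y) ≡ point (x ℤ.- y) (x ℤ.+ y)
  move-point x y = cong₂ _,_
    (trans (linear-residue 1ℤ -1ℤ x y) (cong (residue n) (difference x y)))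
    (trans (linear-residue 1ℤ 1ℤ x y) (cong (residue n) (total x y)))
    where
    difference : ∀ x y → 1ℤ ℤ.* x ℤ.+ -1ℤ ℤ.* y ≡ x ℤ.- y
    difference = solve-∀
    total : ∀ x y → 1ℤ ℤ.* x ℤ.+ 1ℤ ℤ.* y ≡ x ℤ.+ y
    total = solve-∀

  -- With `(x , y)` read as x + iy, the move is multiplication by 1 + i, and (1 + i)² = 2i. Squaring
  -- once more gives the factor -4.
  move²-point : ∀ x y →
    fold (point x y) (move subAdd) 2 ≡ point (ℤ.- (+ 2 ℤ.* y)) (+ 2 ℤ.* x)
  move²-point x y =
    trans (cong (move subAdd) (move-point x y))
          (trans (move-point (x ℤ.- y) (x ℤ.+ y)) (cong₂ point (first x y) (second x y)))
    where
    first : ∀ x y → (x ℤ.- y) ℤ.- (x ℤ.+ y) ≡ ℤ.- (+ 2 ℤ.* y)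
    first = solve-∀
    second : ∀ x y → (x ℤ.- y) ℤ.+ (x ℤ.+ y) ≡ + 2 ℤ.* x
    second = solve-∀

  move⁴-point : ∀ x y →
    fold (point x y) (move subAdd) 4 ≡ point (-4ℤ ℤ.* x) (-4ℤ ℤ.* y)
  move⁴-point x y =
    trans (cong (λ u → fold u (move subAdd) 2) (move²-point x y))
          (trans (move²-point (ℤ.- (+ 2 ℤ.* y)) (+ 2 ℤ.* x)) (cong₂ point (first x) (second y)))
    where
    first : ∀ x → ℤ.- (+ 2 ℤ.* (+ 2 ℤ.* x)) ≡ ℤ.- + 4 ℤ.* x
    first = solve-∀
    second : ∀ y → + 2 ℤ.* (ℤ.- (+ 2 ℤ.* y)) ≡ ℤ.- + 4 ℤ.* y
    second = solve-∀

  -- The count is `m * 4` rather than `4 * m` so that for `suc m` the last four moves split off by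
  -- computation.
  move⁴^-point : ∀ m x y → fold (point x y) (move subAdd) (m * 4) ≡
    point (-4ℤ ℤ.^ m ℤ.* x) (-4ℤ ℤ.^ m ℤ.* y)
  move⁴^-point zero    x y = sym (cong₂ point (ℤ.*-identityˡ x) (ℤ.*-identityˡ y))
  move⁴^-point (suc m) x y = begin
    fold (fold (point x y) (move subAdd) (m * 4)) (move subAdd) 4
      ≡⟨ cong (λ v → fold v (move subAdd) 4) (move⁴^-point m x y) ⟩
    fold (point (c^m ℤ.* x) (c^m ℤ.* y)) (move subAdd) 4
      ≡⟨ move⁴-point (c^m ℤ.* x) (c^m ℤ.* y) ⟩
    point (-4ℤ ℤ.* (c^m ℤ.* x)) (-4ℤ ℤ.* (c^m ℤ.* y))
      ≡⟨ cong₂ point (ℤ.*-assoc -4ℤ c^m x) (ℤ.*-assoc -4ℤ c^m y) ⟨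
    point (-4ℤ ℤ.^ suc m ℤ.* x) (-4ℤ ℤ.^ suc m ℤ.* y)
      ∎
    where
    open ≡-Reasoning
    c^m = -4ℤ ℤ.^ m

  -- Each vertex is the `point` of its own coordinates, and these get multiplied by a power of -4
  -- that is 1 modulo `n`.
  move-period : ∀ m → -4ℤ ℤ.^ m ≈ 1ℤ [mod n ] →
                ∀ u → fold u (move subAdd) (4 * m) ≡ u
  move-period m c^m≈1 u@(a , b) = begin
    fold u (move subAdd) (4 * m)            ≡⟨ cong (fold u (move subAdd)) (*-comm 4 m) ⟩
    fold u (move subAdd) (m * 4)            ≡⟨ cong (λ w → fold w (move subAdd) (m * 4)) u≡point ⟨
    fold (point x y) (move subAdd) (m * 4)  ≡⟨ move⁴^-point m x y ⟩
    point (-4ℤ ℤ.^ m ℤ.* x) (-4ℤ ℤ.^ m ℤ.* y)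
      ≡⟨ cong₂ _,_ (residue-cong (cancel x)) (residue-cong (cancel y)) ⟩
    point x y                               ≡⟨ u≡point ⟩
    u                                       ∎
    where
    open ≡-Reasoning
    x = + toℕ a
    y = + toℕ b
    u≡point : point x y ≡ u
    u≡point = cong₂ _,_ (residue-toℕ a) (residue-toℕ b)
    cancel : ∀ z → -4ℤ ℤ.^ m ℤ.* z ≈ z [mod n ]
    cancel z = ≈-trans (*-cong c^m≈1 ≈-refl) (≈-reflexive (ℤ.*-identityˡ z))

-- Directed cycles of the sub-add graph

-- In `Γ` such an arc says that `v j` is the image of `v i` under the move, so the vertices of a
-- directed cycle are closed under it.
outDegree≡1⇒arc : ∀ (G : Digraph) {k} (v : Fin k → Digraph.Vertex G) i →
  outDegree G v i ≡ 1 → ∃ λ j → Digraph.Arc G (v i) (v j)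
outDegree≡1⇒arc G {k} v i eq
  with filter (λ j → Digraph.arc? G (v i) (v j)) (allFin k) in filtered
... | j ∷ [] = j , proj₂ (∈-filter⁻ (λ j → Digraph.arc? G (v i) (v j)) {xs = allFin k}
                            (subst (j ∈_) (sym filtered) (here refl)))

theorem6p2 : (n : ℕ) → 3 ≤ n → ¬ (2 ∣ n) →
    (k : ℕ) → DirectedCycle (Γ subAdd n) k → k ∣ 4 * φ n
-- Exposing two successors makes `n` nontrivial, as `Euler` asks.
theorem6p2 n@(suc (suc _)) _ 2∤n k cycle =
  cycle-length-∣ (≡-dec _≟ᶠ_ _≟ᶠ_) (move subAdd) {{nonEmpty}} vertex distinct
    (λ i → outDegree≡1⇒arc (Γ subAdd n) vertex i (outDegree≡1 i)) adjacent
    (4 * φ n) (move-period (φ n) (Euler.euler n -4ℤ 4⊥n))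
  where
  open DirectedCycle cycle
  2⊥n : Coprime 2 n
  2⊥n = prime∧∤⇒coprime prime[2] 2∤n
  -- The absolute value of `-4ℤ` computes to 4, so this is the coprimality that `Euler` asks for; it
  -- rests on `n` being odd.
  4⊥n : Coprime 4 n
  4⊥n = coprime-* {2} {2} 2⊥n 2⊥n
theorem6p2 (suc zero) (s≤s ())
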